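{- Let $G$ be a finite simple graph with maximum degree $\Delta(G)\geq 4$, and let $m,n$ be positive integers with $1<m<n$ and $m$ odd. Then $\chi(G^{\frac{m}{n}})\leq\omega(G^{\frac{m}{n}})+2$.
   Context: For a graph $G$ and positive integer $n$, the $n$-subdivision $G^{\frac{1}{n}}$ is obtained from $G$ by replacing each edge with a path of length $n$. For a graph $H$ and positive integer $m$, the $m$-th power $H^m$ is the graph on $V(H)$ in which two distinct vertices are adjacent iff their distance in $H$ is at most $m$. The fractional power is $G^{\frac{m}{n}}=(G^{\frac{1}{n}})^m$. $\chi$ denotes the chromatic number and $\omega$ the clique number. -}

module Defs where

open import Data.Nat using (ℕ; zero; suc; _+_; _*_; _∸_; _≤_; _<_; _⊔_)
open import Data.Fin using (Fin; toℕ)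
open import Data.Bool using (Bool; true; false; if_then_else_; T)
open import Data.List using (List; map; foldr; allFin)
open import Data.Nat.ListAction using (sum)
open import Data.Product using (Σ; ∃; _×_; _,_)
open import Data.Sum using (_⊎_)
open import Relation.Binary.PropositionalEquality using (_≡_; _≢_)

Odd : ℕ → Set
Odd m = ∃ λ k → m ≡ suc (2 * k)

record SimpleGraph (N : ℕ) : Set where
  field
    adj    : Fin N → Fin N → Bool
    sym    : ∀ u v → adj u v ≡ adj v u
    irrefl : ∀ v → adj v v ≡ false
open SimpleGraph public

degree : ∀ {N} → SimpleGraph N → Fin N → ℕ
degree G v = sum (map (λ w → if adj G v w then 1 else 0) (allFin _))

-- maximum degree Δ(G)  (0 for the empty graph)
maxDegree : ∀ {N} → SimpleGraph N → ℕ
maxDegree G = foldr _⊔_ 0 (map (degree G) (allFin _))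

record Graph : Set₁ where
  field
    V   : Set
    _~_ : V → V → Set

data Walk (H : Graph) : Graph.V H → Graph.V H → ℕ → Set where
  nil  : ∀ {x} → Walk H x x 0
  cons : ∀ {x y z ℓ} → Graph._~_ H x y → Walk H y z ℓ → Walk H x z (suc ℓ)

power : Graph → ℕ → Graph
power H m = record
  { V   = Graph.V H
  ; _~_ = λ x y → (x ≢ y) × (∃ λ ℓ → (ℓ ≤ m) × Walk H x y ℓ) }

-- n-subdivision G^{1/n}: each edge {u,v} (u < v) is replaced by the path
-- u = p₀, p₁, …, p_{n-1}, p_n = v, where p_{j+1} = mid u v _ _ j
-- for j : Fin (n ∸ 1).

module _ {N : ℕ} (G : SimpleGraph N) (n : ℕ) where

  data SubV : Set where
    orig : Fin N → SubV
    mid  : (u v : Fin N) → .(toℕ u < toℕ v) → .(T (adj G u v)) → Fin (n ∸ 1) → SubV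

  data SubArc : SubV → SubV → Set where
    arc-oo : ∀ u v → toℕ u < toℕ v → T (adj G u v) → n ≡ 1 →
             SubArc (orig u) (orig v)
    arc-om : ∀ u v .(p : toℕ u < toℕ v) .(a : T (adj G u v)) (j : Fin (n ∸ 1)) →
             toℕ j ≡ 0 → SubArc (orig u) (mid u v p a j)
    arc-mo : ∀ u v .(p : toℕ u < toℕ v) .(a : T (adj G u v)) (j : Fin (n ∸ 1)) →
             suc (toℕ j) ≡ n ∸ 1 → SubArc (mid u v p a j) (orig v)
    arc-mm : ∀ u v .(p : toℕ u < toℕ v) .(a : T (adj G u v)) (j j' : Fin (n ∸ 1)) →
             suc (toℕ j) ≡ toℕ j' → SubArc (mid u v p a j) (mid u v p a j')

subdivision : ∀ {N} → SimpleGraph N → ℕ → Graph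
subdivision G n = record
  { V   = SubV G n
  ; _~_ = λ x y → SubArc G n x y ⊎ SubArc G n y x }

fracPower : ∀ {N} → SimpleGraph N → ℕ → ℕ → Graph
fracPower G m n = power (subdivision G n) m

Clique : Graph → ℕ → Set
Clique H k = Σ (Fin k → Graph.V H) λ f →
  ∀ i j → i ≢ j → Graph._~_ H (f i) (f j)

IsCliqueNumber : Graph → ℕ → Set
IsCliqueNumber H w = Clique H w × (∀ k → Clique H k → k ≤ w)

Colourable : Graph → ℕ → Set
Colourable H k = Σ (Graph.V H → Fin k) λ c →
  ∀ x y → Graph._~_ H x y → c x ≢ c y

IsChromaticNumber : Graph → ℕ → Set
IsChromaticNumber H c = Colourable H c × (∀ k → Colourable H k → c ≤ k)

{-# OPTIONS --safe #-}
-- Write m = 2k + 1 and Δ for the maximum degree.  The ball of radius k around a vertex of degree Δ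
-- is a clique with kΔ + 1 vertices, so it is enough to colour the fractional power with kΔ + 3
-- colours: one for the branch vertices, two further special ones, and one colour (l , i) for every
-- label l < Δ and height 1 ≤ i ≤ k.  The half-edges get Δ labels such that the half-edges at a vertex,
-- and the two halves of an edge, have distinct labels (a König edge colouring of the bipartite graph
-- G^{1/2}, obtained by Kempe changes).  The vertex at height i ≤ k on a half-edge labelled l receives
-- the colour (l , i); the middle of an edge with labels a and b is filled with the special colours
-- and with colours of two labels c, d ∉ {a , b}, which exist since Δ ≥ 4.
module Submission where

open import Defs hiding (sym)
open import Algebra.Properties.CommutativeSemigroup using (x∙yz≈y∙xz)
open import Data.Bool using (Bool; true; false; T; if_then_else_)
open import Data.Bool.Properties using (T?)
open import Data.Empty using (⊥)
open import Data.Fin using (Fin; zero; suc; toℕ; inject≤; fromℕ<; combine; remQuot; join; splitAt)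
import Data.Fin.Properties as Fin
open import Data.Fin.Permutation.Components using (transpose; transpose-inverse)
open import Data.List using (List; []; _∷_; allFin; cartesianProduct; filter; length; lookup; map)
open import Data.List.Membership.Propositional using (_∈_)
open import Data.List.Membership.Propositional.Properties
  using (∈-allFin; ∈-lookup; ∈-filter⁺; ∈-filter⁻; ∈-map⁺; ∈-map⁻;
         ∈-cartesianProduct⁺; foldr-selective)
open import Data.List.Properties using (foldr-preservesᵒ)
open import Data.List.Relation.Unary.All as All using (All; []; _∷_)
open import Data.List.Relation.Unary.AllPairs using (_∷_)
open import Data.List.Relation.Unary.Any as Any using (index)
open import Data.List.Relation.Unary.Any.Properties using (lookup-index)
open import Data.List.Relation.Unary.Unique.Propositional using (Unique)
import Data.List.Relation.Unary.Unique.Propositional.Properties as Unique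
open import Data.Nat
open import Data.Nat.Induction using (<-rec)
open import Data.Nat.ListAction using (sum)
open import Data.Nat.Properties
open import Data.Product using (∃; ∃₂; _×_; _,_; proj₁; proj₂; uncurry)
open import Data.Sum using (_⊎_; inj₁; inj₂; [_,_]′; swap)
open import Data.Vec as Vec using ([]; _∷_)
open import Effect.Monad using (RawMonad)
open import Function using (_∘_)
open import Level using (0ℓ)
open import Relation.Binary using (tri<; tri≈; tri>)
open import Relation.Binary.PropositionalEquality
open import Relation.Nullary
  using (¬_; Dec; yes; no; does; contradiction; recompute; ¬¬-excluded-middle)
open import Relation.Nullary.Decidable using (_×-dec_; dec-true; dec-false; decidable-stable)
open import Relation.Nullary.Negation using (¬¬-Monad; DoubleNegation; ¬¬-map)

-- If `f` were onto, a choice of preimages would map `Fin n` into the smaller `Fin m`, and the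
-- pigeonhole principle would identify two values.
fresh : ∀ {m n} → m < n → (f : Fin m → Fin n) → ∃ λ l → ∀ i → f i ≢ l
fresh {m} {n} m<n f = l , λ i eq → ¬hit (i , eq)
  where
  not-onto : ¬ (∀ l → ∃ λ i → f i ≡ l)
  not-onto g with i , j , i<j , eq ← Fin.pigeonhole m<n (proj₁ ∘ g)
    = Fin.<⇒≢ i<j (trans (sym (proj₂ (g i))) (trans (cong f eq) (proj₂ (g j))))
  missed : ∃ λ l → ¬ (∃ λ i → f i ≡ l)
  missed = Fin.¬∀⟶∃¬ n _ (λ l → Fin.any? λ i → f i Fin.≟ l) not-onto
  l = proj₁ missed
  ¬hit = proj₂ missed

-- Colouring the path that replaces an edge

data Colour (A : Set) : Set where
  centre : Colour A
  apex   : Bool → Colour A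
  -- Heights are shifted: lab l i has height i + 1.
  lab    : A → ℕ → Colour A

module PathColouring (A : Set) (k : ℕ) where

  -- This is `m + 1` for `m = 2k + 1`: positions on one path less than `sep` apart must receive
  -- different colours.
  sep : ℕ
  sep = 2 + (k + k)

  below-sep : ∀ {i} → i < k → suc i < sep
  below-sep i<k = s<s (m<n⇒m<1+n (≤-trans i<k (m≤m+n k k)))

  -- At a vertex u of full degree, a colour of height h whose label l is not a also occurs at distance h
  -- from u on the half-edge labelled l; far-start keeps the two occurrences at distance at least sep.
  record IsPathColouring (n : ℕ) (a b : A) (f : ℕ → Colour A) : Set where
    field
      start       : f 0 ≡ centre
      finish      : f n ≡ centre
      near-start  : ∀ {i} → i < k → f (suc i) ≡ lab a i
      near-finish : ∀ {p i} → i < k → p + suc i ≡ n → f p ≡ lab b i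
      separated   : ∀ {p q} → p < q → q ≤ n → q < p + sep → f p ≢ f q
      far-start   : ∀ {p i l} → p ≤ n → f p ≡ lab l i → l ≢ a → sep ≤ p + suc i
      far-finish  : ∀ {p q i l} → p + q ≡ n → f p ≡ lab l i → l ≢ b → sep ≤ q + suc i
      bounded     : ∀ {p i l} → p ≤ n → f p ≡ lab l i → i < k

  -- The far part uses the colours of c in decreasing height, so that position plus height is sep.
  half : A → A → Bool → ℕ → Colour A
  half a c s zero    = centre
  half a c s (suc p) with <-cmp p k
  ... | tri< _ _ _ = lab a p
  ... | tri≈ _ _ _ = apex s
  ... | tri> _ _ _ = lab c (k + k ∸ p)

  -- The graph of `half` below `sep`. In `far` an equation replaces the truncated subtraction of
  -- `half`, so that positions can be compared by cancellation.
  data Half (a c : A) (s : Bool) : ℕ → Colour A → Set where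
    centre : Half a c s 0 centre
    near   : ∀ {i} → i < k → Half a c s (suc i) (lab a i)
    apex   : Half a c s (suc k) (apex s)
    far    : ∀ {p i} → i < k → p + suc i ≡ sep → Half a c s p (lab c i)

  half-view : ∀ a c s {p} → p < sep → Half a c s p (half a c s p)
  half-view a c s {zero}  _   = centre
  half-view a c s {suc p} p<sep with <-cmp p k
  ... | tri< p<k _ _    = near p<k
  ... | tri≈ _ refl _   = apex
  ... | tri> _ _ k<p    = far below height
    where
    p≤2k : p ≤ k + k
    p≤2k = s≤s⁻¹ (s≤s⁻¹ p<sep)
    below : k + k ∸ p < k
    below = +-cancelˡ-< p _ _ (begin-strict
      p + (k + k ∸ p) ≡⟨ m+[n∸m]≡n p≤2k ⟩
      k + k           <⟨ +-monoˡ-< k k<p ⟩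
      p + k           ∎)
      where open ≤-Reasoning
    height : suc p + suc (k + k ∸ p) ≡ sep
    height = cong suc (trans (+-suc p _) (cong suc (m+[n∸m]≡n p≤2k)))

  half-near : ∀ a c s {i} → i < k → half a c s (suc i) ≡ lab a i
  half-near a c s {i} i<k with <-cmp i k
  ... | tri< _ _ _    = refl
  ... | tri≈ ¬i<k _ _ = contradiction i<k ¬i<k
  ... | tri> ¬i<k _ _ = contradiction i<k ¬i<k

  -- A colour determines its position: near colours have height equal to position, far ones have
  -- height and position adding up to `sep`, and `a ≢ c` keeps the two kinds apart.
  half-injective : ∀ {a c s p q x} → a ≢ c → Half a c s p x → Half a c s q x → p ≡ q
  half-injective a≢c centre    centre     = refl
  half-injective a≢c (near _)  (near _)   = refl
  half-injective a≢c (near _)  (far _ _)  = contradiction refl a≢c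
  half-injective a≢c apex      apex       = refl
  half-injective a≢c (far _ _) (near _)   = contradiction refl a≢c
  half-injective a≢c (far _ e) (far _ e') = +-cancelʳ-≡ _ _ _ (trans e (sym e'))

  -- The apexes differ in their Boolean and all label pairs differ, so only `centre` can be shared.
  half-disjoint : ∀ {a b c d p q x} → a ≢ b → a ≢ d → c ≢ b → c ≢ d →
                  Half a c false p x → Half b d true q x → p ≡ 0 × q ≡ 0
  half-disjoint _ _ _ _ centre    centre    = refl , refl
  half-disjoint a≢b _ _ _ (near _)  (near _)  = contradiction refl a≢b
  half-disjoint _ a≢d _ _ (near _)  (far _ _) = contradiction refl a≢d
  half-disjoint _ _ c≢b _ (far _ _) (near _)  = contradiction refl c≢b
  half-disjoint _ _ _ c≢d (far _ _) (far _ _) = contradiction refl c≢d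

  -- Since `n < 2 sep`, each point is at distance less than `sep` from its nearer end. The start
  -- side is coloured by `half a c false` and the finish side by `half b d true`; they share only
  -- `centre`, whose two occurrences are `n ≥ sep` apart.
  module Short {n : ℕ} {a b c d : A} (sep≤n : sep ≤ n) (n<2sep : n < sep + sep)
               (a≢b : a ≢ b) (a≢c : a ≢ c) (b≢c : b ≢ c)
               (a≢d : a ≢ d) (b≢d : b ≢ d) (c≢d : c ≢ d) where

    colour : ℕ → Colour A
    colour p with p ≤? n ∸ p
    ... | yes _ = half a c false p
    ... | no  _ = half b d true (n ∸ p)

    data View (p q : ℕ) (x : Colour A) : Set where
      left  : p ≤ q → Half a c false p x → View p q x
      right : q < p → Half b d true q x → View p q x

    half≤ : ∀ {p q} → p + q ≡ n → p ≤ q → p < sep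
    half≤ {p} {q} e p≤q = ≰⇒> λ sep≤p →
      <⇒≱ n<2sep (subst (sep + sep ≤_) e (+-mono-≤ sep≤p (≤-trans sep≤p p≤q)))

    colour-left : ∀ {p q} → p + q ≡ n → p ≤ q → colour p ≡ half a c false p
    colour-left {p} {q} refl p≤q with p ≤? n ∸ p
    ... | yes _ = refl
    ... | no ¬h = contradiction (subst (p ≤_) (sym (m+n∸m≡n p q)) p≤q) ¬h

    colour-right : ∀ {p q} → p + q ≡ n → q < p → colour p ≡ half b d true q
    colour-right {p} {q} refl q<p with p ≤? n ∸ p
    ... | yes h = contradiction (subst (p ≤_) (m+n∸m≡n p q) h) (<⇒≱ q<p)
    ... | no _  = cong (half b d true) (m+n∸m≡n p q)

    view : ∀ {p q} → p + q ≡ n → View p q (colour p)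
    view {p} {q} e with p ≤? q
    ... | yes p≤q = left p≤q (subst (Half _ _ _ _) (sym (colour-left e p≤q))
                      (half-view a c false (half≤ e p≤q)))
    ... | no p≰q  = right q<p (subst (Half _ _ _ _) (sym (colour-right e q<p))
                        (half-view b d true (half≤ (trans (+-comm q p) e) (<⇒≤ q<p))))
      where q<p = ≰⇒> p≰q

    near-end : ∀ {p i} → i < k → p + suc i ≡ n → suc i < p
    near-end {p} {i} i<k e = +-cancelʳ-< (suc i) _ _ (begin-strict
      suc i + suc i ≤⟨ +-mono-≤ i<k i<k ⟩
      k + k         <⟨ m<n⇒m<1+n (n<1+n _) ⟩
      sep           ≤⟨ sep≤n ⟩
      n             ≡⟨ e ⟨
      p + suc i     ∎)
      where open ≤-Reasoning

    separated : ∀ {p p' q q'} → p < q → q < p + sep → ∀ {x} →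
                p + p' ≡ n → q + q' ≡ n → View p p' x → View q q' x → ⊥
    separated p<q _ _ _ (left _ u)     (left _ v)     = <⇒≢ p<q (half-injective a≢c u v)
    separated p<q q<p+sep _ e' (left _ u) (right _ v)
      with refl , refl ← half-disjoint a≢b a≢d (≢-sym b≢c) c≢d u v
      = <⇒≱ q<p+sep (≤-trans sep≤n (≤-reflexive (trans (sym e') (+-identityʳ _))))
    separated {p} {p'} {q} {q'} p<q _ e e' (right p'<p _) (left q≤q' _) =
      <⇒≢ (+-mono-< p<q (<-trans p'<p (<-≤-trans p<q q≤q'))) (trans e (sym e'))
    separated {p} {p'} p<q _ e e' (right _ u) (right _ v)
      with refl ← half-injective b≢d u v = <⇒≢ p<q (+-cancelʳ-≡ p' _ _ (trans e (sym e')))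

    -- Label `c` gives equality. A colour with label `b` at height `suc i` sits `suc i` before the
    -- finish, so the sum is `n`. A colour with label `d` is further from the start than from the
    -- finish, where its sum is `sep`.
    far-start : ∀ {p q i l} → p + q ≡ n → View p q (lab l i) → l ≢ a → sep ≤ p + suc i
    far-start e (left _ (near _))     l≢a = contradiction refl l≢a
    far-start e (left _ (far _ e'))   l≢a = ≤-reflexive (sym e')
    far-start e (right _ (near _))    l≢a = ≤-trans sep≤n (≤-reflexive (sym e))
    far-start e (right q<p (far _ e')) l≢a = ≤-trans (≤-reflexive (sym e')) (+-monoˡ-≤ _ (<⇒≤ q<p))

    far-finish : ∀ {p q i l} → p + q ≡ n → View p q (lab l i) → l ≢ b → sep ≤ q + suc i
    far-finish {p} {q} e (left _ (near _))  l≢b =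
      ≤-trans sep≤n (≤-reflexive (trans (sym e) (+-comm p q)))
    far-finish e (left p≤q (far _ e'))      l≢b = ≤-trans (≤-reflexive (sym e')) (+-monoˡ-≤ _ p≤q)
    far-finish e (right _ (near _))         l≢b = contradiction refl l≢b
    far-finish e (right _ (far _ e'))       l≢b = ≤-reflexive (sym e')

    bounded : ∀ {p q i l} → View p q (lab l i) → i < k
    bounded (left _ (near i<k))   = i<k
    bounded (left _ (far i<k _))  = i<k
    bounded (right _ (near i<k))  = i<k
    bounded (right _ (far i<k _)) = i<k

    isPathColouring : IsPathColouring n a b colour
    isPathColouring = record
      { start       = colour-left refl z≤n
      ; finish      = colour-right (+-identityʳ n) (<-≤-trans z<s sep≤n)
      ; near-start  = λ {i} i<k → let e = m∸n+n≡m (≤-trans (<⇒≤ (below-sep i<k)) sep≤n) in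
                        trans (colour-left (trans (+-comm (suc i) _) e) (<⇒≤ (near-end i<k e)))
                              (half-near a c false i<k)
      ; near-finish = λ i<k e → trans (colour-right e (near-end i<k e)) (half-near b d true i<k)
      ; separated   = λ {p} {q} p<q q≤n q<p+sep eq →
                        let e = m+[n∸m]≡n (≤-trans (<⇒≤ p<q) q≤n) ; e' = m+[n∸m]≡n q≤n in
                        separated p<q q<p+sep e e' (view e) (subst (View q (n ∸ q)) (sym eq) (view e'))
      ; far-start   = λ p≤n eq → let e = m+[n∸m]≡n p≤n in far-start e (subst (View _ _) eq (view e))
      ; far-finish  = λ e eq → far-finish e (subst (View _ _) eq (view e))
      ; bounded     = λ {p} p≤n eq → bounded (subst (View _ _) eq (view {p} (m+[n∸m]≡n p≤n)))
      }

  -- A period (centre, a-part, apex, reversed b-part) is prepended; far-start for f with l = b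
  -- separates its b-part from f.
  module Extend {n : ℕ} {a b : A} {f : ℕ → Colour A}
                (sep≤n : sep ≤ n) (a≢b : a ≢ b) (isf : IsPathColouring n a b f) where

    open IsPathColouring

    colour : ℕ → Colour A
    colour p with p <? sep
    ... | yes _ = half a b false p
    ... | no  _ = f (p ∸ sep)

    colour-high : ∀ p → colour (sep + p) ≡ f p
    colour-high p with sep + p <? sep
    ... | yes h = contradiction h (m+n≮m sep p)
    ... | no _  = cong f (m+n∸m≡n sep p)

    colour-low : ∀ {p} → p < sep → colour p ≡ half a b false p
    colour-low {p} p<sep with p <? sep
    ... | yes _ = refl
    ... | no h  = contradiction p<sep h

    data View : ℕ → Colour A → Set where
      low  : ∀ {p x} → p < sep → Half a b false p x → View p x
      high : ∀ p {x} → f p ≡ x → View (sep + p) x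

    view : ∀ p {x} → colour p ≡ x → View p x
    view p refl with p <? sep
    ... | yes p<sep = low p<sep (half-view a b false p<sep)
    ... | no p≮sep  = subst (λ q → View q (f (p ∸ sep))) (m+[n∸m]≡n (≮⇒≥ p≮sep))
                             (high (p ∸ sep) refl)

    separated′ : ∀ {p q} → p < q → q ≤ sep + n → q < p + sep → ∀ {x} → View p x → View q x → ⊥
    separated′ p<q _ _ (low _ u) (low _ v) = <⇒≢ p<q (half-injective a≢b u v)
    separated′ {p} p<q _ q<p+sep (low p<sep u) (high q fq≡x) = cross u
      where
      q<p : q < p
      q<p = +-cancelʳ-< sep _ _ (subst (_< p + sep) (+-comm sep q) q<p+sep)
      p≤n : p ≤ n
      p≤n = <⇒≤ (<-≤-trans p<sep sep≤n)
      no-apex : ∀ {i} → i ≤ k → f i ≢ apex false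
      no-apex {zero}  _   e with () ← trans (sym (start isf)) e
      no-apex {suc i} i<k e with () ← trans (sym (near-start isf i<k)) e
      -- Since `q < p`, a near colour would occur in `f` at both `q` and `p`, because `f` begins
      -- with the same `a`-part. An apex would have to occur among the first `k + 1` values of `f`,
      -- which are `centre` and near colours. A far colour has label `b`, and `far-start` for `f`
      -- forces `p ≤ q`.
      cross : Half a b false p _ → ⊥
      cross centre     = contradiction q<p λ ()
      cross (near i<k) = separated isf q<p p≤n (<-≤-trans p<sep (m≤n+m sep q))
                           (trans fq≡x (sym (near-start isf i<k)))
      cross apex       = no-apex (s≤s⁻¹ q<p) fq≡x
      cross (far _ e)  = <⇒≱ (+-monoˡ-< _ q<p) (≤-trans (≤-reflexive e)
                           (far-start isf (≤-trans (<⇒≤ q<p) p≤n) fq≡x (≢-sym a≢b)))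
    separated′ p<q _ _ (high p _) (low q<sep _) = <⇒≱ p<q (≤-trans (<⇒≤ q<sep) (m≤m+n sep p))
    separated′ p<q q≤ q<p+sep (high p e) (high q e') =
      separated isf (+-cancelˡ-< sep _ _ p<q) (+-cancelˡ-≤ sep _ _ q≤)
        (+-cancelˡ-< sep _ _ (<-≤-trans q<p+sep (≤-reflexive (+-assoc sep p sep))))
        (trans e (sym e'))

    far-start′ : ∀ {p i l} → p ≤ sep + n → View p (lab l i) → l ≢ a → sep ≤ p + suc i
    far-start′ _ (low _ (near _))  l≢a = contradiction refl l≢a
    far-start′ _ (low _ (far _ e)) _   = ≤-reflexive (sym e)
    far-start′ _ (high p _)        _   = ≤-trans (m≤m+n sep p) (m≤m+n _ _)

    far-finish′ : ∀ {p q i l} → p + q ≡ sep + n → View p (lab l i) → l ≢ b → sep ≤ q + suc i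
    far-finish′ {p} {q} e (low _ (near _)) _ =
      ≤-trans (m≤m+n sep n) (≤-reflexive (trans (sym e) (+-comm p q)))
    far-finish′ e (low _ (far _ _)) l≢b = contradiction refl l≢b
    far-finish′ {_} {q} e (high p eq) l≢b =
      far-finish isf (+-cancelˡ-≡ sep _ _ (trans (sym (+-assoc sep p q)) e)) eq l≢b

    bounded′ : ∀ {p i l} → p ≤ sep + n → View p (lab l i) → i < k
    bounded′ _   (low _ (near i<k))  = i<k
    bounded′ _   (low _ (far i<k _)) = i<k
    bounded′ p≤  (high p eq)         = bounded isf (+-cancelˡ-≤ sep _ _ p≤) eq

    near-finish′ : ∀ {p i} → i < k → p + suc i ≡ sep + n → colour p ≡ lab b i
    near-finish′ {p} {i} i<k e with view p refl
    ... | low p<sep _ = contradiction e (<⇒≢ (+-mono-<-≤ p<sep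
                          (≤-trans (<⇒≤ (below-sep i<k)) sep≤n)))
    ... | high q eq   = trans (sym eq) (near-finish isf i<k
                          (+-cancelˡ-≡ sep _ _ (trans (sym (+-assoc sep q _)) e)))

    isPathColouring : IsPathColouring (sep + n) a b colour
    isPathColouring = record
      { start       = colour-low z<s
      ; finish      = trans (colour-high n) (finish isf)
      ; near-start  = λ i<k → trans (colour-low (below-sep i<k)) (half-near a b false i<k)
      ; near-finish = near-finish′
      ; separated   = λ {p} {q} p<q q≤ q<p+sep eq →
                        separated′ p<q q≤ q<p+sep (view p eq) (view q refl)
      ; far-start   = λ p≤ eq → far-start′ p≤ (view _ eq)
      ; far-finish  = λ e eq → far-finish′ e (view _ eq)
      ; bounded     = λ p≤ eq → bounded′ p≤ (view _ eq)
      }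

  -- Lets a path coloured from one end be analysed from the other.
  reverse : ∀ {n a b f} → sep ≤ n →
            IsPathColouring n a b f → IsPathColouring n b a (λ p → f (n ∸ p))
  reverse {n} {f = f} sep≤n isf = record
    { start       = finish isf
    ; finish      = trans (cong f (n∸n≡0 n)) (start isf)
    ; near-start  = λ i<k → near-finish isf i<k
                      (m∸n+n≡m (≤-trans (<⇒≤ (below-sep i<k)) sep≤n))
    ; near-finish = λ { {p} i<k refl → trans (cong f (m+n∸m≡n p _)) (near-start isf i<k) }
    ; separated   = λ {p} {q} p<q q≤n q<p+sep eq → separated isf (∸-monoʳ-< p<q q≤n) (m∸n≤m n p)
                      (gap (<⇒≤ p<q) q≤n q<p+sep) (sym eq)
    ; far-start   = λ p≤n → far-finish isf (m∸n+n≡m p≤n)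
    ; far-finish  = λ { {p} {q} refl eq → far-start isf (m≤n+m q p)
                      (trans (cong f (sym (m+n∸m≡n p q))) eq) }
    ; bounded     = λ {p} _ → bounded isf (m∸n≤m n p)
    }
    where
    open IsPathColouring
    gap : ∀ {p q} → p ≤ q → q ≤ n → q < p + sep → n ∸ p < n ∸ q + sep
    gap {p} {q} p≤q q≤n q<p+sep = +-cancelˡ-< p _ _ (begin-strict
      p + (n ∸ p)       ≡⟨ m+[n∸m]≡n (≤-trans p≤q q≤n) ⟩
      n                 ≡⟨ m∸n+n≡m q≤n ⟨
      n ∸ q + q         <⟨ +-monoʳ-< (n ∸ q) q<p+sep ⟩
      n ∸ q + (p + sep) ≡⟨ x∙yz≈y∙xz +-commutativeSemigroup (n ∸ q) p sep ⟩
      p + (n ∸ q + sep) ∎)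
      where open ≤-Reasoning

  record Four (a b : A) : Set where
    field
      {c d} : A
      a≢c   : a ≢ c
      b≢c   : b ≢ c
      a≢d   : a ≢ d
      b≢d   : b ≢ d
      c≢d   : c ≢ d

  -- Periods of length `sep` are stripped off while `n ≥ 2 sep`; the remaining length is handled by
  -- `Short`, the only place where `c` and `d` occur.
  path-colouring : ∀ {a b n} → a ≢ b → Four a b → sep ≤ n → ∃ λ f → IsPathColouring n a b f
  path-colouring {a} {b} {n} a≢b four = <-rec (λ n → sep ≤ n → ∃ (IsPathColouring n a b)) step n
    where
    open Four four
    step : ∀ n → (∀ {n'} → n' < n → sep ≤ n' → ∃ (IsPathColouring n' a b)) →
           sep ≤ n → ∃ (IsPathColouring n a b)
    step n rec sep≤n with sep + sep ≤? n
    ... | no 2sep≰n = _ , Short.isPathColouring sep≤n (≰⇒> 2sep≰n) a≢b a≢c b≢c a≢d b≢d c≢d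
    ... | yes 2sep≤n with n' , refl ← m≤n⇒∃[o]m+o≡n sep≤n
      with sep≤n' ← +-cancelˡ-≤ sep sep n' 2sep≤n
      = _ , Extend.isPathColouring sep≤n' a≢b (proj₂ (rec (m<n+m n' z<s) sep≤n'))

-- The label `d` has to avoid three others, which is where four labels are used.
four : ∀ {k n} → 4 ≤ n → (a b : Fin n) → PathColouring.Four (Fin n) k a b
four 4≤n a b = record
  { a≢c = c≢ zero ; b≢c = c≢ (suc zero)
  ; a≢d = d≢ zero ; b≢d = d≢ (suc zero) ; c≢d = d≢ (suc (suc zero)) }
  where
  c = fresh (≤-trans (s≤s (s≤s (s≤s z≤n))) 4≤n) (Vec.lookup (a ∷ b ∷ []))
  c≢ = proj₂ c
  d≢ = proj₂ (fresh 4≤n (Vec.lookup (a ∷ b ∷ proj₁ c ∷ [])))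

-- Labelling the half-edges

transpose-injective : ∀ {n} (a b : Fin n) {x y} → transpose a b x ≡ transpose a b y → x ≡ y
transpose-injective a b eq =
  trans (sym (transpose-inverse b a)) (trans (cong (transpose b a) eq) (transpose-inverse b a))

transpose-left : ∀ {n} (a b : Fin n) → transpose a b a ≡ b
transpose-left a b rewrite dec-true (a Fin.≟ a) refl = refl

transpose-right : ∀ {n} (a b : Fin n) → transpose a b b ≡ a
transpose-right a b with b Fin.≟ a
... | yes b≡a = b≡a
... | no _ rewrite dec-true (b Fin.≟ b) refl = refl

transpose-other : ∀ {n} (a b : Fin n) {x} → x ≢ a → x ≢ b → transpose a b x ≡ x
transpose-other a b {x} x≢a x≢b rewrite dec-false (x Fin.≟ a) x≢a | dec-false (x Fin.≟ b) x≢b = refl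

module Edges {N : ℕ} (G : SimpleGraph N) where

  Edge : Fin N → Fin N → Set
  Edge u v = T (adj G u v)

  edge-sym : ∀ {u v} → Edge u v → Edge v u
  edge-sym {u} {v} = subst T (SimpleGraph.sym G u v)

  edge-irrefl : ∀ {v} → ¬ Edge v v
  edge-irrefl {v} = subst T (irrefl G v)

module HalfEdges {N : ℕ} (G : SimpleGraph N) {Δ : ℕ} where

  open Edges G

  -- `L u v` labels the half of the edge `uv` at `u`, and `L v u` the half at `v`.
  Labelling : Set
  Labelling = Fin N → Fin N → Fin Δ

  Proper : Labelling → Set
  Proper L = ∀ u {v w} → Edge u v → Edge u w → L u v ≡ L u w → v ≡ w

  Bad : Labelling → Fin N → Fin N → Set
  Bad L u v = Edge u v × L u v ≡ L v u

  module Swap {L : Labelling} (proper : Proper L) {u v : Fin N} (bad : Bad L u v)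
              {b : Fin Δ} (a≢b : L u v ≢ b) where

    a : Fin Δ
    a = L u v

    -- Reach is the a-b Kempe chain starting at v, followed along arcs.  Every vertex has at most one
    -- incoming arc, and u and v have none as their labels a sit on the edge uv; hence the chain
    -- is closed under predecessors and avoids u.
    Arc : Fin N → Fin N → Set
    Arc w z = Edge w z × L w z ≡ b × L z w ≡ a

    data Reach : Fin N → Set where
      here  : Reach v
      there : ∀ {w z} → Reach w → Arc w z → Reach z

    reach-back : ∀ {w z} → Reach z → Arc w z → Reach w
    reach-back here (e , Lwv≡b , Lvw≡a)
      with refl ← proper v (edge-sym (proj₁ bad)) (edge-sym e) (trans (sym (proj₂ bad)) (sym Lvw≡a))
      = contradiction Lwv≡b a≢b
    reach-back (there r (e' , _ , eq')) (e , _ , eq)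
      with refl ← proper _ (edge-sym e') (edge-sym e) (trans eq' (sym eq)) = r

    ¬reach-u : ¬ Reach u
    ¬reach-u r with r
    ... | here = edge-irrefl (proj₁ bad)
    ... | there _ (e , Lsu≡b , Lus≡a)
      with refl ← proper u (proj₁ bad) (edge-sym e) (sym Lus≡a) = a≢b (trans (proj₂ bad) Lsu≡b)

    module _ (reach? : ∀ w → Dec (Reach w)) where

      -- All half-edges at a reached vertex are relabelled together by a permutation, so properness
      -- survives; only edges with exactly one reached end need care.
      swapped : Labelling
      swapped w z = if does (reach? w) then transpose a b (L w z) else L w z

      swapped-proper : Proper swapped
      swapped-proper w e e' eq with does (reach? w)
      ... | true  = proper w e e' (transpose-injective a b eq)
      ... | false = proper w e e' eq

      -- The half at `v` changes from `a` to `b`, while the half at `u` keeps `a`.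
      fixed : ¬ Bad swapped u v
      fixed (_ , eq) rewrite dec-true (reach? v) here | dec-false (reach? u) ¬reach-u =
        a≢b (trans eq (trans (cong (transpose a b) (sym (proj₂ bad))) (transpose-left a b)))

      -- If the label at `x` were `a` or `b`, equality after the swap would put the other of the two
      -- at `y`. The edge would then be an arc into or out of `x`, making `y` reached. So the swap
      -- leaves the label at `x` unchanged.
      boundary : ∀ {x y} → Reach x → ¬ Reach y → Edge x y →
                 transpose a b (L x y) ≡ L y x → L x y ≡ L y x
      boundary {x} {y} rx ¬ry e eq = relate (L x y Fin.≟ a) (L x y Fin.≟ b)
        where
        relate : Dec (L x y ≡ a) → Dec (L x y ≡ b) → L x y ≡ L y x
        relate (yes Lxy≡a) _ =
          contradiction (reach-back rx (edge-sym e , Lyx≡b , Lxy≡a)) ¬ry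
          where
          Lyx≡b : L y x ≡ b
          Lyx≡b = trans (sym eq) (trans (cong (transpose a b) Lxy≡a) (transpose-left a b))
        relate (no _) (yes Lxy≡b) =
          contradiction (there rx (e , Lxy≡b , Lyx≡a)) ¬ry
          where
          Lyx≡a : L y x ≡ a
          Lyx≡a = trans (sym eq) (trans (cong (transpose a b) Lxy≡b) (transpose-right a b))
        relate (no Lxy≢a) (no Lxy≢b) = trans (sym (transpose-other a b Lxy≢a Lxy≢b)) eq

      swapped-bad : ∀ x y → Bad swapped x y → Bad L x y
      swapped-bad x y (e , eq) with reach? x | reach? y
      ... | yes _  | yes _  = e , transpose-injective a b eq
      ... | yes rx | no ¬ry = e , boundary rx ¬ry e eq
      ... | no ¬rx | yes ry = e , sym (boundary ry ¬rx (edge-sym e) (sym eq))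
      ... | no _   | no _   = e , eq

  open RawMonad (¬¬-Monad {0ℓ})

  -- Reachability is decided only under double negation, which commutes with the finite product over
  -- the vertices. The last component says that no bad edge is created.
  fix : 1 < Δ → ∀ {L} → Proper L → ∀ u v →
        DoubleNegation (∃ λ L' → Proper L' × ¬ Bad L' u v × (∀ x y → Bad L' x y → Bad L x y))
  fix 1<Δ {L} proper u v with T? (adj G u v) ×-dec (L u v Fin.≟ L v u)
  ... | no ¬bad = pure (L , proper , ¬bad , λ _ _ z → z)
  ... | yes bad = do
    reach? ← Fin.sequence rawApplicative (λ w → ¬¬-excluded-middle {A = Reach w})
    pure (swapped reach? , swapped-proper reach? , fixed reach? , swapped-bad reach?)
    where
    b = fresh 1<Δ λ (_ : Fin 1) → L u v
    open Swap proper bad (proj₂ b zero)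

  -- Pairs already repaired stay good, because a later repair creates no bad edge.
  fix-all : 1 < Δ → ∀ {L} → Proper L → ∀ es →
            DoubleNegation (∃ λ L' → Proper L' × All (¬_ ∘ uncurry (Bad L')) es)
  fix-all 1<Δ {L} proper [] = pure (L , proper , [])
  fix-all 1<Δ proper ((u , v) ∷ es) = do
    _ , proper₁ , good₁ ← fix-all 1<Δ proper es
    L₂ , proper₂ , good , bad⇒bad ← fix 1<Δ proper₁ u v
    pure (L₂ , proper₂ , good ∷ All.map (_∘ bad⇒bad _ _) good₁)

  good-labelling : 1 < Δ → ∀ {L} → Proper L →
                   DoubleNegation (∃ λ L' → Proper L' × ∀ u v → ¬ Bad L' u v)
  good-labelling 1<Δ proper = do
    L , proper' , good ← fix-all 1<Δ proper (cartesianProduct (allFin N) (allFin N))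
    pure (L , proper' , λ u v → All.lookup good (∈-cartesianProduct⁺ (∈-allFin u) (∈-allFin v)))

-- The initial proper labelling, by numbering neighbours

lookup-injective : ∀ {A : Set} {xs : List A} → Unique xs →
                   ∀ {i j} → lookup xs i ≡ lookup xs j → i ≡ j
lookup-injective (_ ∷ _)   {zero}  {zero}  _  = refl
lookup-injective (x∉ ∷ _)  {zero}  {suc j} eq = contradiction eq (All.lookup x∉ (∈-lookup j))
lookup-injective (x∉ ∷ _)  {suc i} {zero}  eq = contradiction (sym eq) (All.lookup x∉ (∈-lookup i))
lookup-injective (_ ∷ uxs) {suc i} {suc j} eq = cong suc (lookup-injective uxs eq)

length-filter≡sum : ∀ {A : Set} (f : A → Bool) xs →
                    length (filter (T? ∘ f) xs) ≡ sum (map (λ x → if f x then 1 else 0) xs)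
length-filter≡sum f []       = refl
length-filter≡sum f (x ∷ xs) with f x
... | true  = cong suc (length-filter≡sum f xs)
... | false = length-filter≡sum f xs

module Neighbours {N : ℕ} (G : SimpleGraph N) where

  open Edges G
  open HalfEdges G using (Proper)

  neighbours : Fin N → List (Fin N)
  neighbours u = filter (T? ∘ adj G u) (allFin N)

  neighbours-unique : ∀ u → Unique (neighbours u)
  neighbours-unique u = Unique.filter⁺ (T? ∘ adj G u) (Unique.allFin⁺ N)

  edge⇒∈ : ∀ {u w} → Edge u w → w ∈ neighbours u
  edge⇒∈ e = ∈-filter⁺ (T? ∘ adj G _) (∈-allFin _) e

  ∈⇒edge : ∀ {u w} → w ∈ neighbours u → Edge u w
  ∈⇒edge = proj₂ ∘ ∈-filter⁻ (T? ∘ adj G _) {xs = allFin N}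

  degree≤maxDegree : ∀ u → degree G u ≤ maxDegree G
  degree≤maxDegree u = foldr-preservesᵒ
    (λ x y → [ m≤n⇒m≤n⊔o y , m≤n⇒m≤o⊔n x ]′) 0 (map (degree G) (allFin N))
    (inj₂ (Any.map ≤-reflexive (∈-map⁺ (degree G) (∈-allFin u))))

  maxDegree-attained : 0 < maxDegree G → ∃ λ v → degree G v ≡ maxDegree G
  maxDegree-attained 0<Δ with foldr-selective ⊔-sel 0 (map (degree G) (allFin N))
  ... | inj₁ Δ≡0 = contradiction Δ≡0 (>⇒≢ 0<Δ)
  ... | inj₂ Δ∈ with v , _ , eq ← ∈-map⁻ (degree G) Δ∈ = v , sym eq

  length-neighbours : ∀ u → length (neighbours u) ≡ degree G u
  length-neighbours u = length-filter≡sum (adj G u) (allFin N)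

  -- Numbering the neighbours of each vertex separately makes the labels at a vertex distinct; the
  -- two halves of an edge may still agree, which the Kempe changes repair.
  index-label : 0 < maxDegree G → Fin N → Fin N → Fin (maxDegree G)
  index-label 0<Δ u w with T? (adj G u w)
  ... | yes e = inject≤ (index (edge⇒∈ e))
                  (≤-trans (≤-reflexive (length-neighbours u)) (degree≤maxDegree u))
  -- An arbitrary default off the edges, where `Proper` imposes no condition.
  ... | no _  = fromℕ< 0<Δ

  index-label-proper : (0<Δ : 0 < maxDegree G) → Proper (index-label 0<Δ)
  index-label-proper 0<Δ u {v} {w} e e' eq with T? (adj G u v) | T? (adj G u w)
  ... | no ¬e  | _      = contradiction e ¬e
  ... | yes _  | no ¬e' = contradiction e' ¬e'
  ... | yes e₁ | yes e₂ = trans (lookup-index (edge⇒∈ e₁))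
        (trans (cong (lookup (neighbours u)) (Fin.inject≤-injective _ _ _ _ eq))
               (sym (lookup-index (edge⇒∈ e₂))))


-- Short walks in the subdivision

snoc : ∀ {H x y z ℓ} → Walk H x y ℓ → Graph._~_ H y z → Walk H x z (suc ℓ)
snoc nil        b = cons b nil
snoc (cons a w) b = cons a (snoc w b)

-- Joins two walks out of `x`, later used for two points of a ball around `x`.
reverse-onto : ∀ {H x y z ℓ ℓ'} → (∀ {u v} → Graph._~_ H u v → Graph._~_ H v u) →
               Walk H x y ℓ → Walk H x z ℓ' → Walk H y z (ℓ + ℓ')
reverse-onto ~-sym nil w = w
reverse-onto ~-sym (cons {ℓ = ℓ} a v) w =
  subst (Walk _ _ _) (+-suc ℓ _) (reverse-onto ~-sym v (cons (~-sym a) w))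

module Coordinates {N : ℕ} (G : SimpleGraph N) {n : ℕ} (1<n : 1 < n) where

  open Edges G

  Vertex : Set
  Vertex = SubV G n

  Adj : Vertex → Vertex → Set
  Adj = Graph._~_ (subdivision G n)

  -- On x u w p q: x lies on the path replacing the edge uw, at distance p from u and q from w.
  data On : Vertex → Fin N → Fin N → ℕ → ℕ → Set where
    source   : ∀ {u w p q} → Edge u w → p ≡ 0 → q ≡ n → On (orig u) u w p q
    target   : ∀ {u w p q} → Edge u w → p ≡ n → q ≡ 0 → On (orig w) u w p q
    forward  : ∀ {u w p q} .{lt} .{e} {j} → p ≡ suc (toℕ j) → p + q ≡ n →
               On (mid u w lt e j) u w p q
    backward : ∀ {u w p q} .{lt} .{e} {j} → q ≡ suc (toℕ j) → q + p ≡ n →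
               On (mid u w lt e j) w u p q

  on-reverse : ∀ {x u w p q} → On x u w p q → On x w u q p
  on-reverse (source e p≡0 q≡n) = target (edge-sym e) q≡n p≡0
  on-reverse (target e p≡n q≡0) = source (edge-sym e) q≡0 p≡n
  on-reverse (forward eq s)     = backward eq s
  on-reverse (backward eq s)    = forward eq s

  on-total : ∀ {x u w p q} → On x u w p q → p + q ≡ n
  on-total (source _ refl refl) = refl
  on-total (target _ refl refl) = +-identityʳ n
  on-total (forward _ s)        = s
  on-total {p = p} (backward {q = q} _ s) = trans (+-comm p q) s

  on-edge : ∀ {x u w p q} → On x u w p q → Edge u w
  on-edge (source e _ _)            = e
  on-edge (target e _ _)            = e
  on-edge {u = u} {w} (forward {e = e} _ _) = recompute (T? (adj G u w)) e
  on-edge {u = u} {w} (backward {e = e} _ _) = edge-sym (recompute (T? (adj G w u)) e)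

  on-≤ : ∀ {x u w p q} → On x u w p q → p ≤ n
  on-≤ o = ≤-trans (m≤m+n _ _) (≤-reflexive (on-total o))

  mid-on : ∀ {u w} .{lt e} (j : Fin (n ∸ 1)) →
           On (mid u w lt e j) u w (suc (toℕ j)) (n ∸ suc (toℕ j))
  mid-on j = forward refl (m+[n∸m]≡n (≤-trans (Fin.toℕ<n j) (m∸n≤m n 1)))

  mid-ordered : ∀ {u w : Fin N} → .(toℕ u < toℕ w) → toℕ u < toℕ w
  mid-ordered {u} {w} = recompute (toℕ u <? toℕ w)

  mid-oriented : ∀ {A : Set} {u w : Fin N} → .(toℕ u < toℕ w) → .(toℕ w < toℕ u) → A
  mid-oriented lt lt' = contradiction (mid-ordered lt) (<-asym (mid-ordered lt'))

  0<n : 0 < n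
  0<n = <-trans z<s 1<n

  -- An interior point lies on a single edge, and fixing the end `u` fixes the direction in which it
  -- is read.
  on-unique : ∀ {x u w w' p q p' q'} → 0 < p → p < n → p' < n →
              On x u w p q → On x u w' p' q' → w ≡ w' × p ≡ p'
  on-unique 0<p _ _ (source _ p≡0 _) _ = contradiction (sym p≡0) (<⇒≢ 0<p)
  on-unique _ p<n _ (target _ p≡n _) _ = contradiction p≡n (<⇒≢ p<n)
  on-unique _ _ _ (forward refl _) (forward p'≡ _) = refl , sym p'≡
  on-unique _ _ _ (forward {lt = lt} _ _) (backward _ _) = contradiction refl (<⇒≢ (mid-ordered lt))
  on-unique _ _ _ (backward {lt = lt} _ _) (forward _ _) = contradiction refl (<⇒≢ (mid-ordered lt))
  on-unique {q = q} _ _ _ (backward refl s) (backward refl s') =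
    refl , +-cancelˡ-≡ q _ _ (trans s (sym s'))

  on-orig : ∀ {u w p q} → On (orig u) u w p q → p ≡ 0
  on-orig (source _ p≡0 _) = p≡0
  on-orig (target e _ _)   = contradiction e edge-irrefl

  mid-position : (j : Fin (n ∸ 1)) → suc (toℕ j) < n
  mid-position j = subst (2 + toℕ j ≤_) (m+[n∸m]≡n 0<n) (s≤s (Fin.toℕ<n j))

  mid-interior : ∀ {u w z z' p q} .{lt} .{e} {j} → On (mid u w lt e j) z z' p q → 0 < p × p < n
  mid-interior {j = j} (forward refl _)  = z<s , mid-position j
  mid-interior {p = p} {j = j} (backward refl s) =
    +-cancelˡ-< _ 0 p (subst₂ _<_ (sym (+-identityʳ _)) (sym s) (mid-position j)) ,
    <-≤-trans (m<n+m p z<s) (≤-reflexive s)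

  mid-not-source : ∀ {A : Set} {u w z z' p q} .{lt} .{e} {j} →
                   On (mid u w lt e j) z z' p q → p ≡ 0 → A
  mid-not-source x∈ p≡0 = contradiction (sym p≡0) (<⇒≢ (proj₁ (mid-interior x∈)))

  mid-not-target : ∀ {A : Set} {u w z z' p q} .{lt} .{e} {j} →
                   On (mid u w lt e j) z z' p q → p ≡ n → A
  mid-not-target x∈ p≡n = contradiction p≡n (<⇒≢ (proj₂ (mid-interior x∈)))

  on-injective : ∀ {x y u w p q q'} → On x u w p q → On y u w p q' → x ≡ y
  on-injective (source _ _ _)     (source _ _ _)      = refl
  on-injective (source _ refl _)  (target _ p≡n _)    = contradiction p≡n (<⇒≢ 0<n)
  on-injective (target _ p≡n _)   (source _ refl _)   = contradiction p≡n (<⇒≢ 0<n)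
  on-injective (target _ _ _)     (target _ _ _)      = refl
  on-injective {orig _} {mid _ _ _ _ _} (source _ p≡0 _)  y∈ = mid-not-source y∈ p≡0
  on-injective {orig _} {mid _ _ _ _ _} (target _ p≡n _)  y∈ = mid-not-target y∈ p≡n
  on-injective {mid _ _ _ _ _} {orig _} x∈ (source _ p≡0 _) = mid-not-source x∈ p≡0
  on-injective {mid _ _ _ _ _} {orig _} x∈ (target _ p≡n _) = mid-not-target x∈ p≡n
  on-injective (forward refl _) (forward eq _)
    with refl ← Fin.toℕ-injective (suc-injective eq) = refl
  on-injective (backward {j = j} refl s) (backward {j = j'} refl s')
    with refl ← Fin.toℕ-injective {i = j} {j = j'}
                  (suc-injective (+-cancelʳ-≡ _ _ _ (trans s (sym s')))) = refl
  on-injective (forward {lt = lt} _ _) (backward {lt = lt'} _ _) = mid-oriented lt lt'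
  on-injective (backward {lt = lt} _ _) (forward {lt = lt'} _ _) = mid-oriented lt lt'

  -- The possible neighbours `x` of a point at position `p`. From an end, `branch` and `leave` enter
  -- any incident edge, possibly `uw` itself.
  data Move (x : Vertex) (u w : Fin N) (p q : ℕ) : Set where
    up     : ∀ {q'} → On x u w (suc p) q' → Move x u w p q
    down   : ∀ {p' q'} → p ≡ suc p' → On x u w p' q' → Move x u w p q
    branch : ∀ {w' q'} → p ≡ 0 → On x u w' 1 q' → Move x u w p q
    leave  : ∀ {u' q'} → q ≡ 0 → On x w u' 1 q' → Move x u w p q

  n≢1 : n ≢ 1
  n≢1 n≡1 = <⇒≢ 1<n (sym n≡1)

  n∸1-pos : 1 + (n ∸ 1) ≡ n
  n∸1-pos = m+[n∸m]≡n 0<n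

  from-orig : ∀ {x u} → Adj x (orig u) → ∃₂ λ w q → On x u w 1 q
  from-orig (inj₁ (arc-oo _ _ _ _ n≡1))     = contradiction n≡1 n≢1
  from-orig (inj₁ (arc-mo u v lt e j sj≡)) =
    u , suc (toℕ j) , backward refl (trans (+-comm _ 1) (trans (cong suc sj≡) n∸1-pos))
  from-orig (inj₂ (arc-oo _ _ _ _ n≡1))     = contradiction n≡1 n≢1
  from-orig (inj₂ (arc-om u v lt e j j≡0)) = v , n ∸ 1 , forward (cong suc (sym j≡0)) n∸1-pos

  next-mid : ∀ {x u w} .{lt e} {j} → Adj x (mid u w lt e j) →
             (∃ λ q → On x u w (2 + toℕ j) q) ⊎ (∃ λ q → On x u w (toℕ j) q)
  next-mid {e = e} (inj₁ (arc-om _ _ _ _ j j≡0)) = inj₂ (n , source (recompute (T? _) e) j≡0 refl)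
  next-mid (inj₁ (arc-mm _ _ _ _ i j si≡j)) = inj₂ (n ∸ toℕ j ,
    forward (sym si≡j) (m+[n∸m]≡n (<⇒≤ (<-trans (n<1+n _) (mid-position j)))))
  next-mid {e = e} (inj₂ (arc-mo _ _ _ _ j sj≡)) =
    inj₁ (0 , target (recompute (T? _) e) (trans (cong suc sj≡) n∸1-pos) refl)
  next-mid (inj₂ (arc-mm _ _ _ _ j i sj≡i)) = inj₁ (n ∸ suc (toℕ i) ,
    forward (cong suc sj≡i) (trans (cong (λ z → suc z + (n ∸ suc (toℕ i))) sj≡i)
                                   (m+[n∸m]≡n (<⇒≤ (mid-position i)))))

  move : ∀ {x y u w p q} → Adj x y → On y u w p q → Move x u w p q
  move a (source _ p≡0 _) with _ , _ , o ← from-orig a = branch p≡0 o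
  move a (target _ _ q≡0) with _ , _ , o ← from-orig a = leave q≡0 o
  move a (forward refl _) with next-mid a
  ... | inj₁ (_ , o) = up o
  ... | inj₂ (_ , o) = down refl o
  -- Here `p` counts from the larger endpoint, so a step forward on the stored path decreases `p`.
  move {x} a (backward {p = p} {q} refl s) with next-mid a
  ... | inj₁ (q' , o) =
    down (+-cancelˡ-≡ q _ _ (trans s (trans (sym (on-total o)) (sym (+-suc q q'))))) (on-reverse o)
  ... | inj₂ (q' , o) = up (subst (λ z → On x _ _ z _) q'≡1+p (on-reverse o))
    where
    q'≡1+p : q' ≡ suc p
    q'≡1+p = +-cancelˡ-≡ (pred q) _ _ (trans (on-total o) (trans (sym s) (sym (+-suc (pred q) p))))

  -- What a walk of length `ℓ ≤ n` allows: a single edge with positions at most `ℓ` apart, or two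
  -- edges at a common end `u` with total distance through `u` at most `ℓ`.
  data Near (x y : Vertex) (ℓ : ℕ) : Set where
    equal  : x ≡ y → Near x y ℓ
    along  : ∀ {u w p p' q q'} → On x u w p p' → On y u w q q' → p ≤ q + ℓ → q ≤ p + ℓ → Near x y ℓ
    around : ∀ {u w w' p p' q q'} → w ≢ w' → On x u w p p' → On y u w' q q' → p + q ≤ ℓ → Near x y ℓ

  -- Adjacency supplies the edge, as an isolated original vertex lies on none.
  coordinate : ∀ {x y} → Adj x y → ∃ λ u → ∃ λ w → ∃ λ p → ∃ λ q → On y u w p q
  coordinate {y = orig u} a with w , q , o ← from-orig a =
    u , w , 0 , n , source (on-edge o) refl refl
  coordinate {y = mid u w lt e j} a = u , w , _ , _ , mid-on j

  near-branch : ∀ {x y u w w' q p' q' ℓ} → On x u w' 1 p' → On y u w q q' → q ≤ ℓ → Near x y (suc ℓ)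
  near-branch {w = w} {w'} {q} {ℓ = ℓ} x∈ y∈ q≤ℓ with w' Fin.≟ w
  ... | yes refl = along x∈ y∈ (≤-trans (s≤s z≤n) (m≤n+m (suc ℓ) q)) (m≤n⇒m≤1+n (m≤n⇒m≤1+n q≤ℓ))
  ... | no w'≢w  = around w'≢w x∈ y∈ (s≤s q≤ℓ)

  reverse-≤ : ∀ {p p' q q' ℓ} → p + p' ≡ n → q + q' ≡ n → q ≤ p + ℓ → p' ≤ q' + ℓ
  reverse-≤ {p} {p'} {q} {q'} {ℓ} e e' q≤p+ℓ = +-cancelˡ-≤ p _ _ (begin
    p + p'        ≡⟨ trans e (sym e') ⟩
    q + q'        ≤⟨ +-monoˡ-≤ q' q≤p+ℓ ⟩
    p + ℓ + q'    ≡⟨ +-assoc p ℓ q' ⟩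
    p + (ℓ + q')  ≡⟨ cong (p +_) (+-comm ℓ q') ⟩
    p + (q' + ℓ)  ∎)
    where open ≤-Reasoning

  near-step-along : ∀ {x y z u w p p' q q' ℓ} → Adj x y → On y u w p p' → On z u w q q' →
                    p ≤ q + ℓ → q ≤ p + ℓ → Near x z (suc ℓ)
  near-step-along {p = p} {q = q} {ℓ = ℓ} a y∈ z∈ p≤ q≤ with move a y∈
  ... | up x∈        = along x∈ z∈ (≤-trans (s≤s p≤) (≤-reflexive (sym (+-suc q ℓ))))
                                   (≤-trans q≤ (m≤n⇒m≤1+n (+-monoʳ-≤ p (n≤1+n ℓ))))
  ... | down refl x∈ = along x∈ z∈ (≤-trans (n≤1+n _) (≤-trans p≤ (+-monoʳ-≤ q (n≤1+n ℓ))))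
                                   (≤-trans q≤ (≤-reflexive (sym (+-suc (pred p) ℓ))))
  ... | branch refl x∈ = near-branch x∈ z∈ q≤
  ... | leave refl x∈  = near-branch x∈ (on-reverse z∈) (reverse-≤ (on-total z∈) (on-total y∈) p≤)

  near-step : ∀ {x y z ℓ} → Adj x y → Near y z ℓ → ℓ < n → Near x z (suc ℓ)
  near-step a (equal refl) _ with _ , _ , p , _ , o ← coordinate a =
    near-step-along a o o (m≤m+n p _) (m≤m+n p _)
  near-step a (along y∈ z∈ p≤ q≤) _ = near-step-along a y∈ z∈ p≤ q≤
  near-step {ℓ = ℓ} a (around {p = p} {q = q} w≢w' y∈ z∈ p+q≤ℓ) ℓ<n with move a y∈
  ... | up x∈          = around w≢w' x∈ z∈ (s≤s p+q≤ℓ)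
  ... | down refl x∈   = around w≢w' x∈ z∈ (≤-trans (n≤1+n _) (m≤n⇒m≤1+n p+q≤ℓ))
  ... | branch refl x∈ = near-branch x∈ z∈ p+q≤ℓ
  -- Leaving at the far end would put `y` at distance `n` from `u`, but that distance is at most
  -- `ℓ < n`.
  ... | leave refl x∈  = contradiction (≤-trans (m≤m+n p q) p+q≤ℓ)
                           (<⇒≱ (<-≤-trans ℓ<n (≤-reflexive (trans (sym (on-total y∈)) (+-identityʳ p)))))

  walk-near : ∀ {x y ℓ} → Walk (subdivision G n) x y ℓ → ℓ ≤ n → Near x y ℓ
  walk-near nil        _   = equal refl
  walk-near (cons a w) ℓ≤n = near-step a (walk-near w (<⇒≤ ℓ≤n)) ℓ≤n

  -- Points at a given position and walks to them

  on-exists-forward : ∀ {u w} → toℕ u < toℕ w → Edge u w → ∀ {p q} → p + q ≡ n →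
                      ∃ λ x → On x u w p q
  on-exists-forward {u} lt e {zero} p+q≡n = orig u , source e refl p+q≡n
  on-exists-forward {w = w} lt e {p@(suc _)} {zero} p+q≡n =
    orig w , target e (trans (sym (+-identityʳ p)) p+q≡n) refl
  on-exists-forward {u} {w} lt e {suc j} {suc q} p+q≡n =
    mid u w lt e (fromℕ< j<) , forward (cong suc (sym (Fin.toℕ-fromℕ< j<))) p+q≡n
    where
    j< : j < n ∸ 1
    j< = s≤s⁻¹ (begin
      2 + j           ≤⟨ s≤s (m<m+n j z<s) ⟩
      suc j + suc q   ≡⟨ p+q≡n ⟩
      n               ≡⟨ n∸1-pos ⟨
      1 + (n ∸ 1)     ∎)
      where open ≤-Reasoning

  on-exists : ∀ {u w} → Edge u w → ∀ {p q} → p + q ≡ n → ∃ λ x → On x u w p q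
  on-exists {u} {w} e {p} {q} p+q≡n with <-cmp (toℕ u) (toℕ w)
  ... | tri< u<w _ _ = on-exists-forward u<w e p+q≡n
  ... | tri≈ _ u≡w _ with refl ← Fin.toℕ-injective u≡w = contradiction e edge-irrefl
  ... | tri> _ _ w<u
    with x , o ← on-exists-forward w<u (edge-sym e) (trans (+-comm q p) p+q≡n) = x , on-reverse o

  on-adjacent : ∀ {x y u w p q q'} → On x u w p q → On y u w (suc p) q' → Adj x y
  on-adjacent (source _ refl _) (target _ 1≡n _) = contradiction (sym 1≡n) n≢1
  on-adjacent (source _ refl _) (forward {lt = lt} {e} {j} 1≡ _) =
    inj₁ (arc-om _ _ lt e j (sym (suc-injective 1≡)))
  on-adjacent (source _ refl _) (backward {lt = lt} {e} {j} refl s) =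
    inj₂ (arc-mo _ _ lt e j (suc-injective (trans (+-comm 1 _) (trans s (sym n∸1-pos)))))
  on-adjacent (target _ refl _) y∈ = contradiction (on-≤ y∈) 1+n≰n
  on-adjacent (forward {lt = lt} {e} {j} refl _) (target _ p≡ _) =
    inj₁ (arc-mo _ _ lt e j (suc-injective (trans p≡ (sym n∸1-pos))))
  on-adjacent (forward {lt = lt} {e} {i} refl _) (forward {j = j} p≡ _) =
    inj₁ (arc-mm _ _ lt e i j (suc-injective p≡))
  on-adjacent (forward {lt = lt} _ _) (backward {lt = lt'} _ _) = mid-oriented lt lt'
  on-adjacent {p = p} (backward {lt = lt} {e} {j} refl s) (target _ p≡ _) =
    inj₂ (arc-om _ _ lt e j (suc-injective (+-cancelʳ-≡ p _ 1 (trans s (sym p≡)))))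
  on-adjacent (backward {lt = lt} _ _) (forward {lt = lt'} _ _) = mid-oriented lt lt'
  on-adjacent {p = p} (backward {lt = lt} {e} {i} refl s) (backward {q = q'} {j = j} refl s') =
    inj₂ (arc-mm _ _ lt e j i (suc-injective
      (+-cancelʳ-≡ p _ _ (trans (sym (+-suc q' p)) (trans s' (sym s))))))

  walk-from-orig : ∀ {u w} → Edge u w → ∀ p {q} → p + q ≡ n →
                   ∃ λ x → On x u w p q × Walk (subdivision G n) (orig u) x p
  walk-from-orig e zero    q≡n = _ , source e refl q≡n , nil
  walk-from-orig {u} e (suc p) p+q≡n
    with x , x∈ , walk ← walk-from-orig e p (trans (+-suc p _) p+q≡n) | y , y∈ ← on-exists e p+q≡n
    = y , y∈ , snoc walk (on-adjacent x∈ y∈)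

-- The colouring

Bounded : ∀ {A} → ℕ → Colour A → Set
Bounded k x = ∀ {l i} → x ≡ lab l i → i < k

module Encoding (Δ k : ℕ) where

  -- The pairs of label and height fill `Fin (Δ * k)`; `centre` and the two apexes are the three
  -- extra colours.
  code : Colour (Fin Δ) → Fin (Δ * k) ⊎ Fin 3
  code centre       = inj₂ zero
  code (apex false) = inj₂ (suc zero)
  code (apex true)  = inj₂ (suc (suc zero))
  code (lab l i) with i <? k
  ... | yes i<k = inj₁ (combine l (fromℕ< i<k))
  -- A default for heights out of range, which `Bounded` excludes.
  ... | no  _   = inj₂ zero

  decode : Fin (Δ * k) ⊎ Fin 3 → Colour (Fin Δ)
  decode (inj₁ c) = let l , i = remQuot {Δ} k c in lab l (toℕ i)
  decode (inj₂ zero)             = centre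
  decode (inj₂ (suc zero))       = apex false
  decode (inj₂ (suc (suc zero))) = apex true

  decode-code : ∀ x → Bounded k x → decode (code x) ≡ x
  decode-code centre       _ = refl
  decode-code (apex false) _ = refl
  decode-code (apex true)  _ = refl
  decode-code (lab l i) bounded with i <? k
  ... | yes i<k = cong₂ lab (cong proj₁ split) (trans (cong (toℕ ∘ proj₂) split) (Fin.toℕ-fromℕ< i<k))
    where split = Fin.remQuot-combine l (fromℕ< i<k)
  ... | no i≮k  = contradiction (bounded refl) i≮k

  encode : Colour (Fin Δ) → Fin (Δ * k + 3)
  encode x = join (Δ * k) 3 (code x)

  decode-encode : ∀ x → Bounded k x → decode (splitAt (Δ * k) (encode x)) ≡ x
  decode-encode x bounded =
    trans (cong decode (Fin.splitAt-join (Δ * k) 3 (code x))) (decode-code x bounded)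

  encode-injective : ∀ {x y} → Bounded k x → Bounded k y → encode x ≡ encode y → x ≡ y
  encode-injective {x} {y} bx by eq =
    trans (sym (decode-encode x bx))
      (trans (cong (decode ∘ splitAt (Δ * k)) eq) (decode-encode y by))

module Painting {N : ℕ} (G : SimpleGraph N) {Δ : ℕ} (4≤Δ : 4 ≤ Δ) (k n : ℕ) (m<n : suc (2 * k) < n)
                {L : HalfEdges.Labelling G {Δ}} (proper : HalfEdges.Proper G L)
                (good : ∀ u v → ¬ HalfEdges.Bad G L u v) where

  open PathColouring (Fin Δ) k
  open Edges G
  open Coordinates G (≤-<-trans (s≤s z≤n) m<n)

  sep≡2+2k : sep ≡ 2 + 2 * k
  sep≡2+2k = cong (λ z → 2 + (k + z)) (sym (+-identityʳ k))

  sep≤n : sep ≤ n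
  sep≤n = subst (_≤ n) (sym sep≡2+2k) m<n

  -- Total in the labels, with a constant default for equal ones, so that `paint` can be computed
  -- without the irrelevant edge proof stored in `mid`.
  path : ∀ a b → ∃ λ f → a ≢ b → IsPathColouring n a b f
  path a b with a Fin.≟ b
  ... | yes a≡b = (λ _ → centre) , contradiction a≡b
  ... | no  a≢b with f , isf ← path-colouring a≢b (four 4≤Δ a b) sep≤n = f , λ _ → isf

  -- Each edge has one colouring, chosen from its smaller endpoint and read backwards from the
  -- larger, so that both readings agree with `paint`.
  edgeColour : Fin N → Fin N → ℕ → Colour (Fin Δ)
  edgeColour u w p with toℕ u <? toℕ w
  ... | yes _ = proj₁ (path (L u w) (L w u)) p
  ... | no  _ = proj₁ (path (L w u) (L u w)) (n ∸ p)

  edgeColour-valid : ∀ {u w} → Edge u w → IsPathColouring n (L u w) (L w u) (edgeColour u w)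
  edgeColour-valid {u} {w} e with toℕ u <? toℕ w
  ... | yes _ = proj₂ (path (L u w) (L w u)) λ eq → good u w (e , eq)
  ... | no  _ = reverse sep≤n (proj₂ (path (L w u) (L u w)) λ eq → good u w (e , sym eq))

  open IsPathColouring

  paint : Vertex → Colour (Fin Δ)
  paint (orig _)        = centre
  paint (mid u w _ _ j) = proj₁ (path (L u w) (L w u)) (suc (toℕ j))

  paint-on : ∀ {x u w p q} → On x u w p q → paint x ≡ edgeColour u w p
  paint-on (source e refl _) = sym (start (edgeColour-valid e))
  paint-on (target e refl _) = sym (finish (edgeColour-valid e))
  paint-on {u = u} {w} (forward {lt = lt} refl _) with toℕ u <? toℕ w
  ... | yes _   = refl
  ... | no u≮w  = contradiction (mid-ordered lt) u≮w
  paint-on {u = u} {w} (backward {p = p} {q} {lt = lt} refl s) with toℕ u <? toℕ w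
  ... | yes u<w = contradiction (mid-ordered lt) (<-asym u<w)
  ... | no _    =
    cong (proj₁ (path (L w u) (L u w))) (sym (trans (cong (_∸ p) (sym s)) (m+n∸n≡m q p)))

  paint-bounded : ∀ x → Bounded k (paint x)
  paint-bounded (mid u w lt e j) eq with o ← mid-on {lt = lt} {e} j =
    bounded (edgeColour-valid (on-edge o)) (on-≤ o) (trans (sym (paint-on o)) eq)

  distinct-along : ∀ {x y u w p p' q q'} → x ≢ y → On x u w p p' → On y u w q q' →
                   p < q + sep → q < p + sep → paint x ≢ paint y
  distinct-along {p = p} {q = q} x≢y x∈ y∈ p< q< eq with <-cmp p q
  ... | tri< p<q _ _  = separated (edgeColour-valid (on-edge x∈)) p<q (on-≤ y∈) q<
                          (trans (sym (paint-on x∈)) (trans eq (paint-on y∈)))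
  ... | tri≈ _ refl _ = x≢y (on-injective x∈ y∈)
  ... | tri> _ _ q<p  = separated (edgeColour-valid (on-edge x∈)) q<p (on-≤ x∈) p<
                          (trans (sym (paint-on y∈)) (trans (sym eq) (paint-on x∈)))

  -- The colour of `x` is `lab (L u w) i`. By properness this label differs from `L u w'`, so if `y`
  -- had the same colour, `far-start` on the edge of `y` would give `sep ≤ q + suc i`.
  distinct-near : ∀ {x y u w w' i p' q q'} → w ≢ w' → i < k → On x u w (suc i) p' → On y u w' q q' →
                  suc i + q < sep → paint x ≢ paint y
  distinct-near {u = u} {w} {w'} {i} {q = q} w≢w' i<k x∈ y∈ <sep eq = <⇒≱ <sep (≤-trans
    (far-start (edgeColour-valid (on-edge y∈)) (on-≤ y∈)
      (trans (sym (paint-on y∈)) (trans (sym eq)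
        (trans (paint-on x∈) (near-start (edgeColour-valid (on-edge x∈)) i<k))))
      (w≢w' ∘ proper u (on-edge x∈) (on-edge y∈)))
    (≤-reflexive (+-comm q (suc i))))

  on-centre : ∀ {x u w w' q} → On x u w 0 q → Edge u w' → On x u w' 0 n
  on-centre (source _ _ _) e = source e refl refl
  on-centre (target _ 0≡n _) _ = contradiction 0≡n (<⇒≢ 0<n)
  on-centre {mid _ _ _ _ _} x∈ _ = mid-not-source x∈ refl

  -- If one point is `u` itself, both lie on a common edge. Otherwise `p + q < 2k + 2` forces one
  -- position to be at most `k`, so that point has a near colour.
  distinct-around : ∀ {x y u w w' p p' q q'} → x ≢ y → w ≢ w' → On x u w p p' → On y u w' q q' →
                    p + q < sep → paint x ≢ paint y
  distinct-around {p = zero} {q = q} x≢y _ x∈ y∈ q<sep =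
    distinct-along x≢y (on-centre x∈ (on-edge y∈)) y∈ (≤-trans z<s (m≤n+m sep q)) q<sep
  distinct-around {p = p@(suc _)} {q = zero} x≢y _ x∈ y∈ p<sep =
    distinct-along x≢y x∈ (on-centre y∈ (on-edge x∈)) (subst (_< sep) (+-identityʳ p) p<sep)
      (≤-trans z<s (m≤n+m sep p))
  distinct-around {p = suc i} {q = suc j} x≢y w≢w' x∈ y∈ <sep with i <? k | j <? k
  ... | yes i<k | _       = distinct-near w≢w' i<k x∈ y∈ <sep
  ... | no _    | yes j<k =
    distinct-near (≢-sym w≢w') j<k y∈ x∈ (subst (_< sep) (+-comm (suc i) (suc j)) <sep) ∘ sym
  ... | no i≮k  | no j≮k  =
    contradiction <sep (≤⇒≯ (subst (sep ≤_) (cong suc (sym (+-suc i j)))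
      (s≤s (s≤s (+-mono-≤ (≮⇒≥ i≮k) (≮⇒≥ j≮k))))))

  paint-distinct : ∀ {x y ℓ} → x ≢ y → ℓ < sep → Near x y ℓ → paint x ≢ paint y
  paint-distinct x≢y _ (equal x≡y) = contradiction x≡y x≢y
  paint-distinct x≢y ℓ<sep (along {p = p} {q = q} x∈ y∈ p≤ q≤) =
    distinct-along x≢y x∈ y∈ (≤-<-trans p≤ (+-monoʳ-< q ℓ<sep)) (≤-<-trans q≤ (+-monoʳ-< p ℓ<sep))
  paint-distinct x≢y ℓ<sep (around w≢w' x∈ y∈ ≤ℓ) =
    distinct-around x≢y w≢w' x∈ y∈ (≤-<-trans ≤ℓ ℓ<sep)

  colourable : Colourable (fracPower G (suc (2 * k)) n) (Δ * k + 3)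
  colourable = encode ∘ paint , λ x y (x≢y , ℓ , ℓ≤m , walk) eq →
    paint-distinct x≢y (≤-trans (s≤s ℓ≤m) (≤-reflexive (sym sep≡2+2k)))
      (walk-near walk (≤-trans ℓ≤m (<⇒≤ m<n)))
      (encode-injective (paint-bounded x) (paint-bounded y) eq)
    where open Encoding Δ k

-- The clique

module Ball {N : ℕ} (G : SimpleGraph N) (k n : ℕ) (m<n : suc (2 * k) < n) (v : Fin N) where

  open Edges G
  open Neighbours G
  open Coordinates G (≤-<-trans (s≤s z≤n) m<n)

  d : ℕ
  d = length (neighbours v)

  k<n : k < n
  k<n = ≤-<-trans (≤-trans (m≤m+n k (k + 0)) (n≤1+n _)) m<n

  -- Points of the ball other than `v` are indexed by a neighbour and a distance from 1 to `k`,
  -- packed into `Fin (d * k)`.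
  nbr : Fin (d * k) → Fin N
  nbr i = lookup (neighbours v) (proj₁ (remQuot {d} k i))

  position : Fin (d * k) → ℕ
  position i = suc (toℕ (proj₂ (remQuot {d} k i)))

  position≤k : ∀ i → position i ≤ k
  position≤k i = Fin.toℕ<n (proj₂ (remQuot {d} k i))

  position<n : ∀ i → position i < n
  position<n i = ≤-<-trans (position≤k i) k<n

  nbr-position-injective : ∀ {i j} → nbr i ≡ nbr j → position i ≡ position j → i ≡ j
  nbr-position-injective {i} {j} w≡ p≡ = trans (sym (Fin.combine-remQuot {d} k i))
    (trans (cong₂ combine (lookup-injective (neighbours-unique v) w≡)
                          (Fin.toℕ-injective (suc-injective p≡)))
           (Fin.combine-remQuot {d} k j))

  reached : ∀ i → ∃ λ x → On x v (nbr i) (position i) (n ∸ position i) ×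
                          Walk (subdivision G n) (orig v) x (position i)
  reached i = walk-from-orig (∈⇒edge (∈-lookup (proj₁ (remQuot {d} k i)))) (position i)
                             (m+[n∸m]≡n (<⇒≤ (position<n i)))

  reached-on : ∀ i → On (proj₁ (reached i)) v (nbr i) (position i) (n ∸ position i)
  reached-on i = proj₁ (proj₂ (reached i))

  ball : Fin (suc (d * k)) → Vertex
  ball zero    = orig v
  ball (suc i) = proj₁ (reached i)

  orig≢reached : ∀ i → orig v ≢ proj₁ (reached i)
  orig≢reached i eq with () ← on-orig (subst (λ x → On x v (nbr i) _ _) (sym eq) (reached-on i))

  ball-injective : ∀ {i j} → ball i ≡ ball j → i ≡ j
  ball-injective {zero}  {zero}  _  = refl
  ball-injective {zero}  {suc j} eq = contradiction eq (orig≢reached j)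
  ball-injective {suc i} {zero}  eq = contradiction (sym eq) (orig≢reached i)
  ball-injective {suc i} {suc j} eq
    with w≡ , p≡ ← on-unique z<s (position<n i) (position<n j)
                     (subst (λ x → On x v _ _ _) eq (reached-on i)) (reached-on j)
    = cong suc (nbr-position-injective w≡ p≡)

  radius : ∀ i → ∃ λ ℓ → ℓ ≤ k × Walk (subdivision G n) (orig v) (ball i) ℓ
  radius zero    = 0 , z≤n , nil
  radius (suc i) = position i , position≤k i , proj₂ (proj₂ (reached i))

  -- Any two points of the ball are joined through `v` by a walk of length at most `2k`.
  clique : Clique (fracPower G (suc (2 * k)) n) (suc (d * k))
  clique = ball , λ i j i≢j →
    let ℓ , ℓ≤k , walk = radius i ; ℓ' , ℓ'≤k , walk' = radius j in
    i≢j ∘ ball-injective , ℓ + ℓ' ,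
    m≤n⇒m≤1+n (+-mono-≤ ℓ≤k (≤-trans ℓ'≤k (m≤m+n k 0))) ,
    reverse-onto swap walk walk'

-- Comparison of the colouring with the clique

theorem2 : ∀ {N} (G : SimpleGraph N) (m n : ℕ) →
    4 ≤ maxDegree G → 1 < m → m < n → Odd m →
    ∀ χ ω → IsChromaticNumber (fracPower G m n) χ →
    IsCliqueNumber (fracPower G m n) ω →
    χ ≤ ω + 2
theorem2 G m n 4≤Δ _ m<n (k , refl) χ ω (_ , χ-least) (_ , ω-greatest) =
  -- The labelling exists only under double negation, which the decidable goal absorbs.
  decidable-stable (χ ≤? ω + 2) (¬¬-map bound
    (good-labelling (≤-trans (s≤s (s≤s z≤n)) 4≤Δ) (index-label-proper 0<Δ)))
  where
  open HalfEdges G {maxDegree G}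
  open Neighbours G
  0<Δ = ≤-trans z<s 4≤Δ
  v = proj₁ (maxDegree-attained 0<Δ)

  ball-size : length (neighbours v) ≡ maxDegree G
  ball-size = trans (length-neighbours v) (proj₂ (maxDegree-attained 0<Δ))

  bound : (∃ λ L → Proper L × ∀ u w → ¬ Bad L u w) → χ ≤ ω + 2
  bound (L , proper , good) = begin
    χ                                   ≤⟨ χ-least _ (Painting.colourable G 4≤Δ k n m<n proper good) ⟩
    -- One of the three extra colours is matched with the centre of the ball, leaving the surplus of
    -- two.
    maxDegree G * k + 3                 ≡⟨ +-suc (maxDegree G * k) 2 ⟩
    suc (maxDegree G * k) + 2           ≡⟨ cong (λ d → suc (d * k) + 2) ball-size ⟨
    suc (length (neighbours v) * k) + 2 ≤⟨ +-monoˡ-≤ 2 (ω-greatest _ (Ball.clique G k n m<n v)) ⟩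
    ω + 2                               ∎
    where open ≤-Reasoning
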